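{- Let $(P_1,e_1),\dots,(P_\ell,e_\ell)$ be friendly tree patterns and let $n\ge 0$. Then Algorithm S, applied to the set $\mathcal{L}_n=\mathcal{T}_n((P_1,e_1),\dots,(P_\ell,e_\ell))$ and initialized with the right path $T_0\in\mathcal{T}_n$ (the tree in which no vertex has a left child), visits every binary tree from $\mathcal{T}_n((P_1,e_1),\dots,(P_\ell,e_\ell))$ exactly once.
   Context: For $n\ge 0$, $\mathcal{T}_n$ is the set of binary trees with $n$ vertices, labeled $1,\dots,n$ by the search tree property (left-subtree vertices of $i$ are smaller than $i$, right-subtree vertices larger). For a vertex $i$: $c_L(i),c_R(i),p(i)$ are its left child, right child, parent ($\varepsilon$ if nonexistent); $r(T)$ is the root; $T(i)$, $L(i)$, $R(i)$ are the subtrees rooted at $i$, $c_L(i)$, $c_R(i)$. $B_R(i)=\{i,c_R(i),c_R^2(i),\dots\}$ is the vertex set of the right branch starting at $i$, and $B_R^-(i)$ is $B_R(i)$ minus its last vertex. A tree pattern is $(P,e)$ with $P\in\mathcal{T}_k$, $e\colon[k]\setminus\{r(P)\}\to\{0,1\}$. $T\in\mathcal{T}_n$ contains $(P,e)$ if there is an injection $f\colon[k]\to[n]$ such that for every non-root $i$ of $P$: if $e(i)=1$, $f(i)$ is the left (resp. right) child of $f(p(i))$ when $i$ is the left (resp. right) child of $p(i)$; if $e(i)=0$, $f(i)\in L(f(p(i)))$ (resp. $R(f(p(i)))$) when $i$ is the left (resp. right) child of $p(i)$. Otherwise $T$ avoids it. $\mathcal{T}_n((P_1,e_1),\dots,(P_\ell,e_\ell))$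 is the set of trees in $\mathcal{T}_n$ avoiding all $(P_j,e_j)$. A tree pattern $(P,e)$, $P\in\mathcal{T}_k$, is friendly if: (i) $p(k)\neq\varepsilon$ and $c_L(k)\neq\varepsilon$ (the largest vertex $k$ is neither the root nor a leaf); (ii) $e(j)=0$ for every $j\in B_R^-(r(P))\setminus\{r(P)\}$; (iii) if $e(k)=1$ then $e(c_L(k))=0$. Rotations: for a vertex $j$ with $p(j)\ne\varepsilon$ and $j=c_R(p(j))$, set $i=p(j)$, $Y=L(j)$; the up-rotation of $j$ makes $j$ the child of $p(i)$ in place of $i$ (if $p(i)\ne\varepsilon$), makes $i$ the left child of $j$ and $Y$ the right subtree of $i$. The down-rotation of $j$ is its inverse and is defined iff $c_L(j)\ne\varepsilon$. An up-slide (down-slide) of $j$ by $d$ steps is a sequence of $d$ up-rotations (down-rotations) of $j$. For a set $\mathcal{L}_n\subseteq\mathcal{T}_n$, a slide producing a tree in $\mathcal{L}_n$ is minimal if every slide of the same vertex in the same direction by fewer steps produces a tree not in $\mathcal{L}_n$. Algorithm S (on $\mathcal{L}_n$, initial tree $T_0\in\mathcal{L}_n$): S1. Visit $T_0$. S2. Generate an unvisited tree from $\mathcal{L}_n$ by performing a minimal slide of the largest possible vertex in the most recently visited tree; if no such slide exists, or the direction of the slide is ambiguous, terminate; otherwise visit this tree and repeat S2. -}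

module Defs where

open import Data.Bool using (Bool; true; false)
open import Data.Fin using (Fin; toℕ)
open import Data.List using (List; []; _∷_)
open import Data.List.Membership.Propositional using (_∈_; _∉_)
open import Data.List.Relation.Unary.All using (All)
open import Data.List.Relation.Unary.Unique.Propositional using (Unique)
open import Data.Nat using (ℕ; zero; suc; _<_)
open import Data.Product using (_×_; ∃)
open import Data.Sum using (_⊎_)
open import Function.Bundles using (_⇔_)
open import Function.Definitions using (Injective)
open import Relation.Binary.PropositionalEquality using (_≡_; _≢_)
open import Relation.Nullary using (¬_)

------------------------------------------------------------------------
-- Binary trees

-- Binary trees whose vertices are exactly the labels a, a+1, …, b-1.  The
-- indices enforce the search tree property, so that a tree is determined by
-- its shape and every shape on b-a vertices occurs.
data Tree : ℕ → ℕ → Set where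
  leaf : ∀ {a} → Tree a a
  node : ∀ {a b} (i : ℕ) → Tree a i → Tree (suc i) b → Tree a b

-- The vertices are labelled 0,…,n-1 rather than 1,…,n; [n] becomes Fin n.
𝒯 : ℕ → Set
𝒯 n = Tree 0 n

infix 4 _⊑_ _∈ᵗ_

-- S ⊑ T: S is T(i) for some vertex i of T, or an empty subtree.
data _⊑_ {c d} (S : Tree c d) : ∀ {a b} → Tree a b → Set where
  here  : S ⊑ S
  left  : ∀ {a b i} {l : Tree a i} {r : Tree (suc i) b} → S ⊑ l → S ⊑ node i l r
  right : ∀ {a b i} {l : Tree a i} {r : Tree (suc i) b} → S ⊑ r → S ⊑ node i l r

data _∈ᵗ_ {a b} (i : ℕ) (T : Tree a b) : Set where
  vertex : ∀ {c d} {l : Tree c i} {r : Tree (suc i) d} →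
           node i l r ⊑ T → i ∈ᵗ T

data IsRoot : ∀ {a b} → Tree a b → ℕ → Set where
  root : ∀ {a b i} {l : Tree a i} {r : Tree (suc i) b} → IsRoot (node i l r) i

-- LeftChild T i j: c_L(i) = j in T.
data LeftChild {a b} (T : Tree a b) (i j : ℕ) : Set where
  leftChild : ∀ {c d} {x : Tree c j} {y : Tree (suc j) i} {r : Tree (suc i) d} →
              node i (node j x y) r ⊑ T → LeftChild T i j

-- RightChild T i j: c_R(i) = j in T.
data RightChild {a b} (T : Tree a b) (i j : ℕ) : Set where
  rightChild : ∀ {c d} {l : Tree c i} {x : Tree (suc i) j} {y : Tree (suc j) d} →
               node i l (node j x y) ⊑ T → RightChild T i j

-- Parent T i j: p(i) = j in T.
Parent : ∀ {a b} → Tree a b → ℕ → ℕ → Set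
Parent T i j = LeftChild T j i ⊎ RightChild T j i

-- InLeft T i j: j is a vertex of L(i) in T.
data InLeft {a b} (T : Tree a b) (i j : ℕ) : Set where
  inLeft : ∀ {c d} {l : Tree c i} {r : Tree (suc i) d} →
           node i l r ⊑ T → j ∈ᵗ l → InLeft T i j

-- InRight T i j: j is a vertex of R(i) in T.
data InRight {a b} (T : Tree a b) (i j : ℕ) : Set where
  inRight : ∀ {c d} {l : Tree c i} {r : Tree (suc i) d} →
            node i l r ⊑ T → j ∈ᵗ r → InRight T i j

-- RightBranch T i j: j ∈ B_R(i), for a vertex i of T.
data RightBranch {a b} (T : Tree a b) (i : ℕ) : ℕ → Set where
  start : i ∈ᵗ T → RightBranch T i i
  next  : ∀ {j j′} → RightBranch T i j → RightChild T j j′ → RightBranch T i j′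

-- RightBranch⁻ T i j: j ∈ B_R⁻(i).  The last vertex of a right branch is its
-- only vertex without a right child.
RightBranch⁻ : ∀ {a b} → Tree a b → ℕ → ℕ → Set
RightBranch⁻ T i j = RightBranch T i j × ∃ λ j′ → RightChild T j j′

addLast : ∀ {a b} → Tree a b → Tree a (suc b)
addLast (leaf {a})   = node a leaf leaf
addLast (node i l r) = node i l (addLast r)

rightPath : ∀ n → 𝒯 n
rightPath zero    = leaf
rightPath (suc n) = addLast (rightPath n)

private
  addLast-noLeftChild : ∀ {a b} (T : Tree a b) → (∀ i j → ¬ LeftChild T i j) →
                        ∀ i j → ¬ LeftChild (addLast T) i j
  addLast-noLeftChild leaf _ _ _ (leftChild (left ()))
  addLast-noLeftChild leaf _ _ _ (leftChild (right ()))
  addLast-noLeftChild (node k _ r) h i j (leftChild here)     = h i j (leftChild here)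
  addLast-noLeftChild (node k l r) h i j (leftChild (left s)) = h i j (leftChild (left s))
  addLast-noLeftChild (node k l r) h i j (leftChild (right s)) =
    addLast-noLeftChild r (λ { i j (leftChild s) → h i j (leftChild (right s)) })
                        i j (leftChild s)

rightPath-noLeftChild : ∀ n i j → ¬ LeftChild (rightPath n) i j
rightPath-noLeftChild zero    _ _ (leftChild ())
rightPath-noLeftChild (suc n) =
  addLast-noLeftChild (rightPath n) (rightPath-noLeftChild n)

------------------------------------------------------------------------
-- Tree patterns

-- The value e i is true for e(i) = 1 and false for e(i) = 0.  The map e is
-- total on [k], but its value at the root of P is never used.
record TreePattern : Set where
  field
    k : ℕ
    P : 𝒯 k
    e : Fin k → Bool

record Contains {n} (T : 𝒯 n) (π : TreePattern) : Set where
  open TreePattern π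
  field
    f           : Fin k → Fin n
    f-injective : Injective _≡_ _≡_ f
    left-edge   : ∀ i p → LeftChild P (toℕ p) (toℕ i) →
                  (e i ≡ true  → LeftChild T (toℕ (f p)) (toℕ (f i))) ×
                  (e i ≡ false → InLeft T (toℕ (f p)) (toℕ (f i)))
    right-edge  : ∀ i p → RightChild P (toℕ p) (toℕ i) →
                  (e i ≡ true  → RightChild T (toℕ (f p)) (toℕ (f i))) ×
                  (e i ≡ false → InRight T (toℕ (f p)) (toℕ (f i)))

-- Avoiding πs T: T ∈ 𝒯_n(πs).
Avoiding : List TreePattern → ∀ {n} → 𝒯 n → Set
Avoiding πs T = All (λ π → ¬ Contains T π) πs

record Friendly (π : TreePattern) : Set where
  open TreePattern π
  field
    max         : Fin k
    max-largest : suc (toℕ max) ≡ k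
    max-nonroot : ∃ λ p → Parent P (toℕ max) p
    max-nonleaf : ∃ λ c → LeftChild P (toℕ max) c
    branch      : ∀ r (j : Fin k) → IsRoot P r → RightBranch⁻ P r (toℕ j) →
                  toℕ j ≢ r → e j ≡ false
    max-edge    : e max ≡ true → ∀ (c : Fin k) →
                  LeftChild P (toℕ max) (toℕ c) → e c ≡ false

------------------------------------------------------------------------
-- Rotations and slides

data UpRotation (j : ℕ) : ∀ {a b} → Tree a b → Tree a b → Set where
  rotate : ∀ {a b i} {X : Tree a i} {Y : Tree (suc i) j} {Z : Tree (suc j) b} →
           UpRotation j (node i X (node j Y Z)) (node j (node i X Y) Z)
  left   : ∀ {a b i} {l l′ : Tree a i} {r : Tree (suc i) b} →
           UpRotation j l l′ → UpRotation j (node i l r) (node i l′ r)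
  right  : ∀ {a b i} {l : Tree a i} {r r′ : Tree (suc i) b} →
           UpRotation j r r′ → UpRotation j (node i l r) (node i l r′)

data Direction : Set where
  up down : Direction

opposite : Direction → Direction
opposite up   = down
opposite down = up

Rotation : Direction → ℕ → ∀ {a b} → Tree a b → Tree a b → Set
Rotation up   j T T′ = UpRotation j T T′
Rotation down j T T′ = UpRotation j T′ T

-- Slide δ j d T T′: the slide of j by d steps in direction δ turns T into T′.
data Slide (δ : Direction) (j : ℕ) {a b} : ℕ → Tree a b → Tree a b → Set where
  done : ∀ {T} → Slide δ j zero T T
  step : ∀ {d T T′ T″} → Rotation δ j T T′ → Slide δ j d T′ T″ →
         Slide δ j (suc d) T T″

-- Slides have at least one step, also those that a minimal slide is compared
-- with: otherwise no slide of a tree in ℒ would be minimal.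
record MinimalSlide {n} (ℒ : 𝒯 n → Set) (δ : Direction) (j : ℕ) (T T′ : 𝒯 n) : Set where
  field
    steps    : ℕ
    nonempty : 0 < steps
    slide    : Slide δ j steps T T′
    inside   : ℒ T′
    minimal  : ∀ d T″ → 0 < d → d < steps → Slide δ j d T T″ → ¬ ℒ T″

------------------------------------------------------------------------
-- Algorithm S

module AlgorithmS {n} (ℒ : 𝒯 n → Set) (T₀ : 𝒯 n) where

  -- Histories list the visited trees, the most recently visited one first.
  History : Set
  History = List (𝒯 n)

  NewSlide : History → 𝒯 n → Direction → ℕ → 𝒯 n → Set
  NewSlide h T δ j T′ = MinimalSlide ℒ δ j T T′ × T′ ∉ h

  -- One successful execution of S2, with visited trees T ∷ h.
  record S2 (T : 𝒯 n) (h : History) (T′ : 𝒯 n) : Set where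
    field
      δ           : Direction
      j           : ℕ
      new         : NewSlide (T ∷ h) T δ j T′
      largest     : ∀ δ′ j′ T″ → j < j′ → ¬ NewSlide (T ∷ h) T δ′ j′ T″
      unambiguous : ∀ T″ → ¬ NewSlide (T ∷ h) T (opposite δ) j T″

  data Reachable : History → Set where
    visit₀ : Reachable (T₀ ∷ [])
    visit  : ∀ {T h T′} → Reachable (T ∷ h) → S2 T h T′ → Reachable (T′ ∷ T ∷ h)

  -- Run h: the algorithm terminates, having visited exactly the trees in h.
  data Run : History → Set where
    terminate : ∀ {T h} → Reachable (T ∷ h) → (∀ T′ → ¬ S2 T h T′) → Run (T ∷ h)

  VisitsExactlyOnce : Set
  VisitsExactlyOnce =
    (∃ λ h → Run h) × (∀ h → Run h → Unique h × (∀ T → ℒ T ⇔ T ∈ h))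

{-# OPTIONS --safe #-}

-- The trees with vertices 0,…,n arise from the trees with vertices 0,…,n-1 by
-- inserting n into the right branch: as the root, as the last vertex of the
-- branch, or in between, with the lower part of the branch as left subtree of n.
-- The slides of n run exactly through the insertions into a fixed tree.
--
-- Friendliness makes the avoidance classes zigzag languages: deleting n preserves
-- avoidance, because an insertion subdivides one edge of the right branch, which
-- can only destroy the image of the edge into the largest pattern vertex, and then
-- n can replace the image of that vertex; and inserting n as root or as last vertex
-- preserves avoidance, because the largest pattern vertex is neither root nor leaf.
--
-- Hence a run on n vertices lifts to a run on n+1 vertices: each visited tree is
-- replaced by its insertions that lie in the class, with n sliding alternately all
-- the way up and all the way down.  At the end of such a sweep n has no new slide,
-- and the slides of the smaller vertices are those of the tree without n.
module Submission where

open import Data.Bool using (true; false)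
import Data.Bool.Properties as Bool
open import Data.Fin using (Fin; zero; suc; toℕ; fromℕ; fromℕ<; inject₁; lower₁)
import Data.Fin.Properties as Fin
open import Data.List using (List; []; _∷_)
open import Data.List.Membership.Propositional using (_∈_; _∉_)
open import Data.List.Relation.Unary.All as All using (All; []; _∷_)
open import Data.List.Relation.Unary.All.Properties using (¬Any⇒All¬)
open import Data.List.Relation.Unary.AllPairs using ([]; _∷_)
open import Data.List.Relation.Unary.Any using (here; there)
open import Data.List.Relation.Unary.Unique.Propositional using (Unique)
open import Data.Nat using (ℕ; zero; suc; _+_; _≤_; _<_; _≰_; z≤n; s≤s; s≤s⁻¹)
open import Data.Nat.Properties
open import Data.Product using (_×_; _,_; ∃; proj₁; proj₂)
open import Data.Sum using (_⊎_; inj₁; inj₂)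
open import Data.Vec.Functional using () renaming ([] to []ᶠ; _∷_ to _∷ᶠ_)
open import Function using (_∘_; case_of_)
open import Function.Bundles using (_⇔_; mk⇔; Equivalence)
open import Relation.Binary.Definitions using (tri<; tri≈; tri>)
open import Relation.Binary.PropositionalEquality
open import Relation.Nullary using (¬_; Dec; yes; no; contradiction)
open import Relation.Nullary.Decidable using (map′; ¬?; _×-dec_; _→-dec_)
open import Defs

private
  variable
    a b c d i j m u v x y : ℕ

-- Search trees

tree-≤ : Tree a b → a ≤ b
tree-≤ leaf         = ≤-refl
tree-≤ (node i l r) = ≤-trans (tree-≤ l) (<⇒≤ (tree-≤ r))

⊑-≤ˡ : {S : Tree c d} {T : Tree a b} → S ⊑ T → a ≤ c
⊑-≤ˡ here              = ≤-refl
⊑-≤ˡ (left s)          = ⊑-≤ˡ s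
⊑-≤ˡ (right {l = l} s) = ≤-trans (tree-≤ l) (<⇒≤ (⊑-≤ˡ s))

⊑-≤ʳ : {S : Tree c d} {T : Tree a b} → S ⊑ T → d ≤ b
⊑-≤ʳ here             = ≤-refl
⊑-≤ʳ (left {r = r} s) = ≤-trans (⊑-≤ʳ s) (<⇒≤ (tree-≤ r))
⊑-≤ʳ (right s)        = ⊑-≤ʳ s

⊑-trans : ∀ {a′ b′} {R : Tree a b} {S : Tree c d} {T : Tree a′ b′} →
          R ⊑ S → S ⊑ T → R ⊑ T
⊑-trans p here      = p
⊑-trans p (left q)  = left (⊑-trans p q)
⊑-trans p (right q) = right (⊑-trans p q)

module _ {T : Tree a b} {l : Tree c i} {r : Tree (suc i) d} where

  node-≥ : node i l r ⊑ T → a ≤ i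
  node-≥ s = ≤-trans (⊑-≤ˡ s) (tree-≤ l)

  node-< : node i l r ⊑ T → i < b
  node-< s = ≤-trans (tree-≤ r) (⊑-≤ʳ s)

∈-≥ : {T : Tree a b} → i ∈ᵗ T → a ≤ i
∈-≥ (vertex s) = node-≥ s

∈-< : {T : Tree a b} → i ∈ᵗ T → i < b
∈-< (vertex s) = node-< s

∈-⊑ : {S : Tree c d} {T : Tree a b} → S ⊑ T → i ∈ᵗ S → i ∈ᵗ T
∈-⊑ p (vertex s) = vertex (⊑-trans s p)

vertex-of : (T : Tree a b) → a ≤ i → i < b → i ∈ᵗ T
vertex-of leaf a≤i i<a = contradiction a≤i (<⇒≱ i<a)
vertex-of {i = i} (node k l r) a≤i i<b with <-cmp i k
... | tri< i<k _ _  = ∈-⊑ (left here) (vertex-of l a≤i i<k)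
... | tri≈ _ refl _ = vertex here
... | tri> _ _ k<i  = ∈-⊑ (right here) (vertex-of r k<i i<b)

module _ {k} {l : Tree a k} {r : Tree (suc k) b} {x : Tree c i} {y : Tree (suc i) d} where

  -- Labels locate occurrences: comparing `i` with the root label tells on which side a subtree
  -- rooted at `i` lies. Later arguments that a vertex occurs only once descend in this way.
  in-left-subtree : i < k → node i x y ⊑ node k l r → node i x y ⊑ l
  in-left-subtree i<k here      = contradiction refl (<⇒≢ i<k)
  in-left-subtree i<k (left s)  = s
  in-left-subtree i<k (right s) = contradiction (node-≥ s) (≤⇒≯ (<⇒≤ i<k))

  in-right-subtree : k < i → node i x y ⊑ node k l r → node i x y ⊑ r
  in-right-subtree k<i here      = contradiction refl (<⇒≢ k<i)
  in-right-subtree k<i (left s)  = contradiction (node-< s) (<⇒≯ k<i)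
  in-right-subtree k<i (right s) = s

module _ {T : Tree a b} where

  LeftChild⇒InLeft : LeftChild T i j → InLeft T i j
  LeftChild⇒InLeft (leftChild s) = inLeft s (vertex here)

  RightChild⇒InRight : RightChild T i j → InRight T i j
  RightChild⇒InRight (rightChild s) = inRight s (vertex here)

  InLeft⇒< : InLeft T i j → j < i
  InLeft⇒< (inLeft s j∈l) = ∈-< j∈l

  InRight⇒> : InRight T i j → i < j
  InRight⇒> (inRight s j∈r) = ∈-≥ j∈r

  InLeft⇒∈ : InLeft T i j → i ∈ᵗ T × j ∈ᵗ T
  InLeft⇒∈ (inLeft s j∈l) = vertex s , ∈-⊑ s (∈-⊑ (left here) j∈l)

  InRight⇒∈ : InRight T i j → i ∈ᵗ T × j ∈ᵗ T
  InRight⇒∈ (inRight s j∈r) = vertex s , ∈-⊑ s (∈-⊑ (right here) j∈r)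

  module _ {S : Tree c d} (S⊑T : S ⊑ T) where

    LeftChild-⊑ : LeftChild S i j → LeftChild T i j
    LeftChild-⊑ (leftChild s) = leftChild (⊑-trans s S⊑T)

    RightChild-⊑ : RightChild S i j → RightChild T i j
    RightChild-⊑ (rightChild s) = rightChild (⊑-trans s S⊑T)

    InLeft-⊑ : InLeft S i j → InLeft T i j
    InLeft-⊑ (inLeft s j∈l) = inLeft (⊑-trans s S⊑T) j∈l

    InRight-⊑ : InRight S i j → InRight T i j
    InRight-⊑ (inRight s j∈r) = inRight (⊑-trans s S⊑T) j∈r

InLeft-subtree : {T : Tree a b} {l : Tree c i} {r : Tree (suc i) d} →
                 InLeft T y i → node i l r ⊑ T → j ∈ᵗ node i l r → InLeft T y j
InLeft-subtree (inLeft here i∈l) s j∈S =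
  inLeft here (∈-⊑ (in-left-subtree (∈-< i∈l) s) j∈S)
InLeft-subtree (inLeft (left q) i∈l) s j∈S =
  InLeft-⊑ (left here) (InLeft-subtree (inLeft q i∈l) (in-left-subtree i<k s) j∈S)
  where i<k = ∈-< (proj₂ (InLeft⇒∈ (inLeft q i∈l)))
InLeft-subtree (inLeft (right q) i∈l) s j∈S =
  InLeft-⊑ (right here) (InLeft-subtree (inLeft q i∈l) (in-right-subtree k<i s) j∈S)
  where k<i = ∈-≥ (proj₂ (InLeft⇒∈ (inLeft q i∈l)))

-- If x < y shared the right child i, then y would lie in R(x), whose root is i, and, being smaller
-- than i, in L(i); so i would lie in its own left subtree.
RightChild-parent-≮ : {T : Tree a b} → RightChild T x i → RightChild T y i → ¬ x < y
RightChild-parent-≮ (rightChild here) ci@(rightChild t) x<y =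
  <-irrefl refl (∈-< (proj₂ (InRight⇒∈ (RightChild⇒InRight (rightChild
    (in-left-subtree (InRight⇒> (RightChild⇒InRight ci)) (in-right-subtree x<y t)))))))
RightChild-parent-≮ (rightChild (left s)) ci@(rightChild t) x<y =
  RightChild-parent-≮ (rightChild s) (rightChild (in-left-subtree y<k t)) x<y
  where y<k = <-trans (InRight⇒> (RightChild⇒InRight ci))
                      (∈-< (proj₂ (InRight⇒∈ (RightChild⇒InRight (rightChild s)))))
RightChild-parent-≮ (rightChild (right s)) (rightChild t) x<y =
  RightChild-parent-≮ (rightChild s) (rightChild (in-right-subtree k<y t)) x<y
  where k<y = <-trans (node-≥ s) x<y

RightChild-injective : {T : Tree a b} → RightChild T x i → RightChild T y i → x ≡ y
RightChild-injective p q =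
  ≤-antisym (≮⇒≥ (RightChild-parent-≮ q p)) (≮⇒≥ (RightChild-parent-≮ p q))

-- Decidability of containment

isRoot? : (T : Tree a b) → ∀ i → Dec (IsRoot T i)
isRoot? leaf         i = no λ ()
isRoot? (node k l r) i = map′ (λ { refl → root }) (λ { root → refl }) (k ≟ i)

_∈ᵗ?_ : ∀ i (T : Tree a b) → Dec (i ∈ᵗ T)
_∈ᵗ?_ {a} {b} i T = map′ (λ { (a≤i , i<b) → vertex-of T a≤i i<b })
                         (λ i∈T → ∈-≥ i∈T , ∈-< i∈T) ((a ≤? i) ×-dec (i <? b))

module _ {i} (Q : ∀ {c d} → Tree c i → Tree (suc i) d → Set) where

  -- The common shape of `LeftChild`, `RightChild`, `InLeft` and `InRight` at a fixed `i`, so that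
  -- one decision procedure serves all four.
  data AtVertex {a b} (T : Tree a b) : Set where
    at : {l : Tree c i} {r : Tree (suc i) d} → node i l r ⊑ T → Q l r → AtVertex T

  atVertex? : (∀ {c d} (l : Tree c i) (r : Tree (suc i) d) → Dec (Q l r)) →
              (T : Tree a b) → Dec (AtVertex T)
  atVertex? Q? leaf = no λ { (at () _) }
  atVertex? Q? (node k l r) with i ≟ k | atVertex? Q? l | atVertex? Q? r
  ... | _ | yes (at s q) | _ = yes (at (left s) q)
  ... | _ | _ | yes (at s q) = yes (at (right s) q)
  ... | no i≢k | no ¬l | no ¬r = no λ
    { (at here _)      → i≢k refl
    ; (at (left s) q)  → ¬l (at s q)
    ; (at (right s) q) → ¬r (at s q) }
  ... | yes refl | no ¬l | no ¬r = map′ (at here) (λ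
    { (at here q)      → q
    ; (at (left s) q)  → contradiction (at s q) ¬l
    ; (at (right s) q) → contradiction (at s q) ¬r }) (Q? l r)

leftChild? : (T : Tree a b) → ∀ i j → Dec (LeftChild T i j)
leftChild? T i j = map′ (λ { (at s root) → leftChild s }) (λ { (leftChild s) → at s root })
                        (atVertex? (λ l r → IsRoot l j) (λ l r → isRoot? l j) T)

rightChild? : (T : Tree a b) → ∀ i j → Dec (RightChild T i j)
rightChild? T i j = map′ (λ { (at s root) → rightChild s }) (λ { (rightChild s) → at s root })
                         (atVertex? (λ l r → IsRoot r j) (λ l r → isRoot? r j) T)

inLeft? : (T : Tree a b) → ∀ i j → Dec (InLeft T i j)
inLeft? T i j = map′ (λ { (at s q) → inLeft s q }) (λ { (inLeft s q) → at s q })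
                     (atVertex? (λ l r → j ∈ᵗ l) (λ l r → j ∈ᵗ? l) T)

inRight? : (T : Tree a b) → ∀ i j → Dec (InRight T i j)
inRight? T i j = map′ (λ { (at s q) → inRight s q }) (λ { (inRight s q) → at s q })
                      (atVertex? (λ l r → j ∈ᵗ r) (λ l r → j ∈ᵗ? r) T)

-- The enumeration by values at `zero` and `suc` reaches each function only up to pointwise
-- equality, which is why `Q` is assumed to respect `_≗_`.
∃-function? : ∀ {k n} {Q : (Fin k → Fin n) → Set} → (∀ {f g} → f ≗ g → Q f → Q g) →
              (∀ f → Dec (Q f)) → Dec (∃ Q)
∃-function? {zero} resp Q? =
  map′ ([]ᶠ ,_) (λ { (f , q) → resp (λ ()) q }) (Q? []ᶠ)
∃-function? {suc k} {Q = Q} resp Q? =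
  map′ (λ { (x , g , q) → x ∷ᶠ g , q })
       (λ { (f , q) → f zero , f ∘ suc , resp (λ { zero → refl ; (suc i) → refl }) q })
       (Fin.any? λ x → ∃-function? {Q = λ g → Q (x ∷ᶠ g)}
          (λ f≗g → resp (λ { zero → refl ; (suc i) → f≗g i })) (λ g → Q? (x ∷ᶠ g)))

module _ {n} (T : 𝒯 n) (π : TreePattern) where
  open TreePattern π

  Edge : (Fin k → Fin n) → Fin k → Fin k → Set
  Edge f i p =
    (f i ≡ f p → i ≡ p) ×
    (LeftChild P (toℕ p) (toℕ i) →
      (e i ≡ true  → LeftChild T (toℕ (f p)) (toℕ (f i))) ×
      (e i ≡ false → InLeft T (toℕ (f p)) (toℕ (f i)))) ×
    (RightChild P (toℕ p) (toℕ i) →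
      (e i ≡ true  → RightChild T (toℕ (f p)) (toℕ (f i))) ×
      (e i ≡ false → InRight T (toℕ (f p)) (toℕ (f i))))

  Edge-resp : ∀ {f g} → f ≗ g → (∀ i p → Edge f i p) → ∀ i p → Edge g i p
  Edge-resp f≗g E i p with E i p
  ... | E-ip rewrite f≗g i | f≗g p = E-ip

  edge? : ∀ f i p → Dec (Edge f i p)
  edge? f i p =
    ((f i Fin.≟ f p) →-dec (i Fin.≟ p)) ×-dec
    (leftChild? P (toℕ p) (toℕ i) →-dec
      (((e i Bool.≟ true) →-dec leftChild? T (toℕ (f p)) (toℕ (f i))) ×-dec
       ((e i Bool.≟ false) →-dec inLeft? T (toℕ (f p)) (toℕ (f i))))) ×-dec
    (rightChild? P (toℕ p) (toℕ i) →-dec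
      (((e i Bool.≟ true) →-dec rightChild? T (toℕ (f p)) (toℕ (f i))) ×-dec
       ((e i Bool.≟ false) →-dec inRight? T (toℕ (f p)) (toℕ (f i)))))

  -- A sweep has to test whether the next insertion belongs to the class. `Edge` gathers all
  -- conditions on a pair of pattern vertices, so that containment is a finite search with finite
  -- quantifiers inside.
  contains? : Dec (Contains T π)
  contains? = map′
    (λ { (f , E) → record
      { f           = f
      ; f-injective = λ {i} {p} → proj₁ (E i p)
      ; left-edge   = λ i p → proj₁ (proj₂ (E i p))
      ; right-edge  = λ i p → proj₂ (proj₂ (E i p)) } })
    (λ C → let open Contains C in
       f , λ i p → f-injective , left-edge i p , right-edge i p)
    (∃-function? Edge-resp λ f → Fin.all? λ i → Fin.all? λ p → edge? f i p)

-- Insertion of a new largest vertex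

-- Ins d T U: U is T with the vertex b inserted into the right branch at depth d,
-- the part of the branch at depth d and below becoming its left subtree.
data Ins : ∀ {a b} → ℕ → Tree a b → Tree a (suc b) → Set where
  top   : ∀ {a b} {T : Tree a b} → Ins 0 T (node b T leaf)
  below : ∀ {a b i d} {l : Tree a i} {r : Tree (suc i) b} {r′ : Tree (suc i) (suc b)} →
          Ins d r r′ → Ins (suc d) (node i l r) (node i l r′)

branchLength : Tree a b → ℕ
branchLength leaf         = 0
branchLength (node i l r) = suc (branchLength r)

-- The insertion at which the slides of the new vertex in direction δ end.
ext : Direction → Tree a b → Tree a (suc b)
ext up   T = node _ T leaf
ext down T = addLast T

Ins-addLast : (T : Tree a b) → Ins (branchLength T) T (addLast T)
Ins-addLast leaf         = top
Ins-addLast (node i l r) = below (Ins-addLast r)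

Ins-≤ : {T : Tree a b} {U : Tree a (suc b)} → Ins d T U → d ≤ branchLength T
Ins-≤ top       = z≤n
Ins-≤ (below p) = s≤s (Ins-≤ p)

Ins-functional : {T : Tree a b} {U V : Tree a (suc b)} → Ins d T U → Ins d T V → U ≡ V
Ins-functional top top = refl
Ins-functional (below p) (below q) with refl ← Ins-functional p q = refl

Ins-injective : ∀ {d′} {T T′ : Tree a b} {U : Tree a (suc b)} →
                Ins d T U → Ins d′ T′ U → d ≡ d′ × T ≡ T′
Ins-injective top top = refl , refl
Ins-injective top (below ())
Ins-injective (below ()) top
Ins-injective (below p) (below q) with refl , refl ← Ins-injective p q = refl , refl

-- The largest vertex is the last one of the right branch; replacing it by its left subtree undoes
-- the insertion. The bound `a ≤ b` says that `U` is nonempty and is re-established for each right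
-- subtree entered.
Ins-surjective : a ≤ b → (U : Tree a (suc b)) → ∃ λ T → ∃ λ d → Ins {a} {b} d T U
Ins-surjective a≤b leaf = contradiction a≤b 1+n≰n
Ins-surjective a≤b (node i l leaf) = l , 0 , top
Ins-surjective a≤b (node i l r@(node _ l′ r′)) with Ins-surjective (≤-trans (tree-≤ l′) (s≤s⁻¹ (tree-≤ r′))) r
... | T , d , p = node i l T , suc d , below p

-- Rotations of the new vertex

UpRotation-> : {T U : Tree a b} → UpRotation j T U → a < j
UpRotation-> (rotate {X = X} {Y = Y}) = ≤-trans (s≤s (tree-≤ X)) (tree-≤ Y)
UpRotation-> (left q) = UpRotation-> q
UpRotation-> (right {l = l} q) = <-trans (s≤s (tree-≤ l)) (UpRotation-> q)

UpRotation-< : {T U : Tree a b} → UpRotation j T U → j < b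
UpRotation-< (rotate {Z = Z}) = tree-≤ Z
UpRotation-< (left {r = r} q) = <-trans (UpRotation-< q) (tree-≤ r)
UpRotation-< (right q) = UpRotation-< q

-- The label bounds exclude a rotation of `b` anywhere off the right branch; on it, `b` trades
-- places with its parent, which joins L(b).
Ins-up : {T : Tree a b} {U V : Tree a (suc b)} → Ins d T U → UpRotation b U V →
         ∃ λ d′ → d ≡ suc d′ × Ins d′ T V
Ins-up top (left q) = contradiction (UpRotation-< q) (<-irrefl refl)
Ins-up (below top) rotate = 0 , refl , top
Ins-up (below (below {r = r} _)) rotate = contradiction (tree-≤ r) (<-irrefl refl)
Ins-up (below {r = r} _) (left q) = contradiction (UpRotation-< q) (<⇒≯ (tree-≤ r))
Ins-up (below p) (right q) with d′ , refl , p′ ← Ins-up p q = suc d′ , refl , below p′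

Ins-down : {T : Tree a b} {U V : Tree a (suc b)} → Ins d T U → UpRotation b V U →
           Ins (suc d) T V
Ins-down top rotate = below top
Ins-down top (left q) = contradiction (UpRotation-< q) (<-irrefl refl)
Ins-down (below {r = r} _) rotate = contradiction (tree-≤ r) (<-irrefl refl)
Ins-down (below {r = r} _) (left q) = contradiction (UpRotation-< q) (<⇒≯ (tree-≤ r))
Ins-down (below p) (right q) = below (Ins-down p q)

rotatable-up : {T : Tree a b} {U : Tree a (suc b)} → Ins (suc d) T U → ∃ (UpRotation b U)
rotatable-up (below top)         = _ , rotate
rotatable-up (below p@(below _)) with _ , q ← rotatable-up p = _ , right q

rotatable-down : {T : Tree a b} {U : Tree a (suc b)} → Ins d T U → d < branchLength T →
                 ∃ λ V → UpRotation b V U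
rotatable-down {T = leaf} top ()
rotatable-down {T = node _ _ _} top _ = _ , rotate
rotatable-down (below p) (s≤s d<) with _ , q ← rotatable-down p d< = _ , right q

-- Rotations of the other vertices when the new vertex is root or last

module _ {n : ℕ} where

  ext-rotation : ∀ δ′ δ {T T′ : Tree a n} → Rotation δ j T T′ → Rotation δ j (ext δ′ T) (ext δ′ T′)
  ext-rotation up up q = left q
  ext-rotation up down q = left q
  ext-rotation down up q = addLast-up q
    where
    addLast-up : ∀ {a b} {T T′ : Tree a b} → UpRotation j T T′ → UpRotation j (addLast T) (addLast T′)
    addLast-up rotate = rotate
    addLast-up (left q) = left q
    addLast-up (right q) = right (addLast-up q)
  ext-rotation down down q = ext-rotation down up q

addLast-up⁻¹ : {T : Tree a b} {U : Tree a (suc b)} → j ≢ b → UpRotation j (addLast T) U →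
               ∃ λ T′ → U ≡ addLast T′ × UpRotation j T T′
addLast-up⁻¹ {T = leaf} j≢b (left ())
addLast-up⁻¹ {T = leaf} j≢b (right ())
-- Only the new vertex itself can be rotated over the last vertex of `T`.
addLast-up⁻¹ {T = node i l leaf} j≢b rotate = contradiction refl j≢b
addLast-up⁻¹ {T = node i l (node j Y Z)} j≢b rotate = _ , refl , rotate
addLast-up⁻¹ {T = node i l r} j≢b (left q) = _ , refl , left q
addLast-up⁻¹ {T = node i l r} j≢b (right q)
  with _ , refl , q′ ← addLast-up⁻¹ {T = r} j≢b q = _ , refl , right q′

addLast-down⁻¹ : {T : Tree a b} {U : Tree a (suc b)} → UpRotation j U (addLast T) →
                 ∃ λ T′ → U ≡ addLast T′ × UpRotation j T′ T
addLast-down⁻¹ {T = leaf} (left ())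
addLast-down⁻¹ {T = leaf} (right ())
addLast-down⁻¹ {T = node i (node _ _ _) r} rotate = _ , refl , rotate
addLast-down⁻¹ {T = node i l r} (left q) = _ , refl , left q
addLast-down⁻¹ {T = node i l r} (right q)
  with _ , refl , q′ ← addLast-down⁻¹ {T = r} q = _ , refl , right q′

module _ {n : ℕ} where

  -- With n as root the others form its left subtree; with n as last vertex it hangs below the
  -- branch without a left child. Either way a rotation of another vertex is one of `T` and leaves n
  -- at its end. An insertion in between would break a branch edge, and with it a rotation.
  ext-rotation⁻¹ : ∀ δ′ δ {T : Tree a n} {U} → j ≢ n → Rotation δ j (ext δ′ T) U →
                   ∃ λ T′ → U ≡ ext δ′ T′ × Rotation δ j T T′
  ext-rotation⁻¹ up up j≢n (left q) = _ , refl , q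
  ext-rotation⁻¹ up down j≢n rotate = contradiction refl j≢n
  ext-rotation⁻¹ up down j≢n (left q) = _ , refl , q
  ext-rotation⁻¹ down up j≢n q = addLast-up⁻¹ j≢n q
  ext-rotation⁻¹ down down j≢n q = addLast-down⁻¹ q

  ext-slide : ∀ δ′ {δ} {T T′ : Tree a n} → Slide δ j d T T′ → Slide δ j d (ext δ′ T) (ext δ′ T′)
  ext-slide δ′ done = done
  ext-slide δ′ {δ} (step q s) = step (ext-rotation δ′ δ q) (ext-slide δ′ s)

  ext-slide⁻¹ : ∀ δ′ {δ} {T : Tree a n} {U} → j ≢ n → Slide δ j d (ext δ′ T) U →
                ∃ λ T′ → U ≡ ext δ′ T′ × Slide δ j d T T′
  ext-slide⁻¹ δ′ j≢n done = _ , refl , done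
  ext-slide⁻¹ δ′ {δ} j≢n (step q s) with _ , refl , q′ ← ext-rotation⁻¹ δ′ δ j≢n q
    with _ , refl , s′ ← ext-slide⁻¹ δ′ j≢n s = _ , refl , step q′ s′

-- Determinism of rotations and slides

up-functional : {T U V : Tree a b} → UpRotation j T U → UpRotation j T V → U ≡ V
up-functional rotate rotate = refl
up-functional (rotate {Y = Y}) (left q) = contradiction (UpRotation-< q) (<⇒≯ (tree-≤ Y))
-- Here `j` is the root of the right subtree, and a root has no up-rotation.
up-functional rotate (right q) = contradiction q root-fixed
  where
  root-fixed : ∀ {a b j} {l : Tree a j} {r : Tree (suc j) b} {V} → ¬ UpRotation j (node j l r) V
  root-fixed (rotate {Y = Y}) = 1+n≰n (tree-≤ Y)
  root-fixed (left q) = <-irrefl refl (UpRotation-< q)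
  root-fixed (right q) = 1+n≰n (<⇒≤ (UpRotation-> q))
up-functional p@(left _) q@rotate = sym (up-functional q p)
up-functional (left p) (left q) = cong (λ l → node _ l _) (up-functional p q)
up-functional (left p) (right q) = contradiction (UpRotation-< p) (<⇒≯ (<⇒≤ (UpRotation-> q)))
up-functional p@(right _) q@rotate = sym (up-functional q p)
up-functional (right p) (left q) = contradiction (UpRotation-< q) (<⇒≯ (<⇒≤ (UpRotation-> p)))
up-functional (right p) (right q) = cong (node _ _) (up-functional p q)

down-functional : {T U V : Tree a b} → UpRotation j U T → UpRotation j V T → U ≡ V
down-functional rotate rotate = refl
down-functional rotate (left q) = contradiction (UpRotation-< q) (<-irrefl refl)
down-functional rotate (right q) = contradiction (<⇒≤ (UpRotation-> q)) 1+n≰n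
down-functional p@(left _) q@rotate = sym (down-functional q p)
down-functional (left p) (left q) = cong (λ l → node _ l _) (down-functional p q)
down-functional (left p) (right q) = contradiction (UpRotation-< p) (<⇒≯ (<⇒≤ (UpRotation-> q)))
down-functional p@(right _) q@rotate = sym (down-functional q p)
down-functional (right p) (left q) = contradiction (UpRotation-< q) (<⇒≯ (<⇒≤ (UpRotation-> p)))
down-functional (right p) (right q) = cong (node _ _) (down-functional p q)

slide-functional : ∀ δ {T U V : Tree a b} → Slide δ j d T U → Slide δ j d T V → U ≡ V
slide-functional δ done done = refl
slide-functional up (step p s) (step q t) with refl ← up-functional p q = slide-functional up s t
slide-functional down (step p s) (step q t) with refl ← down-functional p q = slide-functional down s t

-- Friendly patterns under insertion and deletion of the largest vertex

child-≢-root : ∀ {r} {T : Tree a b} → IsRoot T r → RightChild T i j → j ≢ r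
child-≢-root root c@(rightChild here)    = >⇒≢ (InRight⇒> (RightChild⇒InRight c))
child-≢-root root (rightChild (left s))  =
  <⇒≢ (∈-< (proj₂ (InRight⇒∈ (RightChild⇒InRight (rightChild s)))))
child-≢-root root (rightChild (right s)) =
  >⇒≢ (∈-≥ (proj₂ (InRight⇒∈ (RightChild⇒InRight (rightChild s)))))

RightBranch-right : ∀ {k} {l : Tree a k} {x : Tree (suc k) i} {y : Tree (suc i) b} →
                    RightBranch (node i x y) i j → RightBranch (node k l (node i x y)) k j
RightBranch-right (start _)   = next (start (vertex here)) (rightChild here)
RightBranch-right (next rb c) = next (RightBranch-right rb) (RightChild-⊑ (right here) c)

-- Outside all left subtrees only the right branch from the root remains, and the vertex of it
-- without a right child is the largest one.
position : (T : Tree a b) → x ∈ᵗ T →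
           (∃ λ y → InLeft T y x) ⊎
           ((∃ λ r → IsRoot T r × RightBranch T r x) × ((∃ λ j → RightChild T x j) ⊎ suc x ≡ b))
position (node i l leaf) (vertex here) =
  inj₂ ((_ , root , start (vertex here)) , inj₂ refl)
position (node i l (node _ _ _)) (vertex here) =
  inj₂ ((_ , root , start (vertex here)) , inj₁ (_ , rightChild here))
position (node i l r) (vertex (left s)) = inj₁ (i , inLeft here (vertex s))
position (node i l r@(node _ _ _)) (vertex (right s)) with position r (vertex s)
... | inj₁ (y , p) = inj₁ (y , InLeft-⊑ (right here) p)
... | inj₂ ((_ , root , rb) , inj₁ (j , c)) =
  inj₂ ((_ , root , RightBranch-right rb) , inj₁ (j , RightChild-⊑ (right here) c))
... | inj₂ ((_ , root , rb) , inj₂ eq) = inj₂ ((_ , root , RightBranch-right rb) , inj₂ eq)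

vertexFin : {P : 𝒯 m} → i ∈ᵗ P → ∃ λ (x : Fin m) → toℕ x ≡ i
vertexFin i∈P = fromℕ< (∈-< i∈P) , Fin.toℕ-fromℕ< (∈-< i∈P)

Fin-∈ : (T : 𝒯 m) (x : Fin m) → toℕ x ∈ᵗ T
Fin-∈ T x = vertex-of T z≤n (Fin.toℕ<n x)

-- Positions of the images of pattern vertices

module _ {n} {T : 𝒯 n} {π : TreePattern} (C : Contains T π) where
  open TreePattern π
  open Contains C

  left-edge-InLeft : ∀ {i p} → LeftChild P (toℕ p) (toℕ i) → InLeft T (toℕ (f p)) (toℕ (f i))
  left-edge-InLeft {i} {p} c with e i | left-edge i p c
  ... | true  | edge , _ = LeftChild⇒InLeft (edge refl)
  ... | false | _ , edge = edge refl

  right-edge-InRight : ∀ {i p} → RightChild P (toℕ p) (toℕ i) → InRight T (toℕ (f p)) (toℕ (f i))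
  right-edge-InRight {i} {p} c with e i | right-edge i p c
  ... | true  | edge , _ = RightChild⇒InRight (edge refl)
  ... | false | _ , edge = edge refl

  -- Induction along the path of `P` from `s` down to `x`: a pattern edge of either kind keeps the
  -- image inside the subtree already reached. The vertex `p` is `s` as an element of `Fin k`.
  subtree-InLeft : ∀ {s} (l : Tree c s) (r : Tree (suc s) d) → node s l r ⊑ P →
                   ∀ {p x} → toℕ p ≡ s → toℕ x ∈ᵗ node s l r →
                   InLeft T y (toℕ (f p)) → InLeft T y (toℕ (f x))
  subtree-InLeft l r S {p} {x} eq (vertex here) q
    rewrite Fin.toℕ-injective {i = p} {j = x} eq = q
  subtree-InLeft leaf r S eq (vertex (left ())) q
  subtree-InLeft (node s′ l′ r′) r S refl (vertex (left t)) q
    with vertexFin (vertex (⊑-trans (left here) S))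
  ... | c , refl with left-edge-InLeft {i = c} (leftChild S)
  ...   | inLeft S′ c∈ =
    subtree-InLeft l′ r′ (⊑-trans (left here) S) refl (vertex t)
      (InLeft-subtree q S′ (∈-⊑ (left here) c∈))
  subtree-InLeft l leaf S eq (vertex (right ())) q
  subtree-InLeft l (node s′ l′ r′) S refl (vertex (right t)) q
    with vertexFin (vertex (⊑-trans (right here) S))
  ... | c , refl with right-edge-InRight {i = c} (rightChild S)
  ...   | inRight S′ c∈ =
    subtree-InLeft l′ r′ (⊑-trans (right here) S) refl (vertex t)
      (InLeft-subtree q S′ (∈-⊑ (right here) c∈))

  embedding-InLeft : ∀ {y x} → InLeft P (toℕ y) (toℕ x) → InLeft T (toℕ (f y)) (toℕ (f x))
  embedding-InLeft (inLeft {l = leaf} S (vertex ()))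
  embedding-InLeft (inLeft {l = node s l r} S x∈) with vertexFin (vertex (⊑-trans (left here) S))
  ... | c , refl =
    subtree-InLeft l r (⊑-trans (left here) S) refl x∈ (left-edge-InLeft {i = c} (leftChild S))

  -- Any pattern vertex but the largest lies in the left subtree of some vertex or has a right
  -- child; that vertex or child has a larger image.
  embedding-not-largest : ∀ x → suc (toℕ x) ≢ k → suc (toℕ (f x)) ≢ n
  embedding-not-largest x x≢max fx≡max with position P (Fin-∈ P x)
  ... | inj₁ (y , q) with vertexFin (proj₁ (InLeft⇒∈ q))
  ...   | y′ , refl = <⇒≱ (InLeft⇒< (embedding-InLeft {y′} {x} q))
                          (s≤s⁻¹ (subst (toℕ (f y′) <_) (sym fx≡max) (Fin.toℕ<n (f y′))))
  embedding-not-largest x x≢max fx≡max | inj₂ (_ , inj₂ eq) = x≢max eq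
  embedding-not-largest x x≢max fx≡max | inj₂ (_ , inj₁ (j , c))
    with vertexFin (proj₂ (InRight⇒∈ (RightChild⇒InRight c)))
  ... | j′ , refl = <⇒≱ (InRight⇒> (right-edge-InRight {i = j′} {p = x} c))
                        (s≤s⁻¹ (subst (toℕ (f j′) <_) (sym fx≡max) (Fin.toℕ<n (f j′))))

  -- Embeddings map left subtrees into left subtrees, so `i` lies on the right branch from the root
  -- of `P`. Being a right child it is not the root, and unless it is the last vertex friendliness
  -- would force e = 0.
  right-branch-vertex : Friendly π → ∀ {i} → RightChild P y (toℕ i) → e i ≡ true →
                        (∀ w → ¬ InLeft T w (toℕ (f i))) → suc (toℕ i) ≡ k
  right-branch-vertex F {i} c ei notInLeft with position P (Fin-∈ P i)
  ... | inj₁ (y , q) with vertexFin (proj₁ (InLeft⇒∈ q))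
  ...   | y′ , refl = contradiction (embedding-InLeft {y′} {i} q) (notInLeft _)
  right-branch-vertex F c ei notInLeft | inj₂ (_ , inj₂ eq) = eq
  right-branch-vertex F {i} c ei notInLeft | inj₂ ((r , isRoot , rb) , inj₁ (j , c′)) =
    contradiction (trans (sym ei) (Friendly.branch F r i isRoot (rb , j , c′) (child-≢-root isRoot c)))
                  λ ()

-- Edges of a tree under insertion and deletion

module _ where

  private variable T : Tree a b
                   U : Tree a (suc b)

  LeftChild-insert : Ins d T U → LeftChild T u v → LeftChild U u v
  LeftChild-insert top       c                       = LeftChild-⊑ (left here) c
  LeftChild-insert (below p) (leftChild here)        = leftChild here
  LeftChild-insert (below p) (leftChild (left s))    = leftChild (left s)
  LeftChild-insert (below p) (leftChild (right s))   =
    LeftChild-⊑ (right here) (LeftChild-insert p (leftChild s))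

  InLeft-insert : Ins d T U → InLeft T u v → InLeft U u v
  InLeft-insert top       q                     = InLeft-⊑ (left here) q
  InLeft-insert (below p) (inLeft here v∈)      = inLeft here v∈
  InLeft-insert (below p) (inLeft (left s) v∈)  = inLeft (left s) v∈
  InLeft-insert (below p) (inLeft (right s) v∈) =
    InLeft-⊑ (right here) (InLeft-insert p (inLeft s v∈))

  InRight-insert : Ins d T U → InRight T u v → InRight U u v
  InRight-insert top       q                      = InRight-⊑ (left here) q
  InRight-insert (below p) (inRight here v∈)      =
    -- A subtree contains exactly the labels within its bounds, and the insertion raises only the
    -- upper bound.
    inRight here (vertex-of _ (∈-≥ v∈) (m<n⇒m<1+n (∈-< v∈)))
  InRight-insert (below p) (inRight (left s) v∈)  = inRight (left s) v∈
  InRight-insert (below p) (inRight (right s) v∈) =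
    InRight-⊑ (right here) (InRight-insert p (inRight s v∈))

  -- The only edge that an insertion destroys is the edge (u, v) of the right
  -- branch which the new vertex subdivides.
  record Subdivides {a b} (T : Tree a b) (U : Tree a (suc b)) (u v : ℕ) : Set where
    field
      on-right-branch : ∀ w → ¬ InLeft T w v
      new-child       : RightChild U u b
      new-left        : ∀ w → InLeft T v w → InLeft U b w

  RightChild-insert : Ins d T U → RightChild T u v → RightChild U u v ⊎ Subdivides T U u v
  RightChild-insert top c = inj₁ (RightChild-⊑ (left here) c)
  RightChild-insert (below (below p)) (rightChild here) = inj₁ (rightChild here)
  -- The new vertex enters directly between u and v, and the subtree rooted at v becomes L(b).
  RightChild-insert (below top) c@(rightChild here) = inj₂ record
    { on-right-branch = λ
      { w (inLeft here v∈)             → <⇒≯ u<v (∈-< v∈)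
      ; w (inLeft (left s) v∈)         → <⇒≯ u<v (<-trans (∈-< v∈) (node-< s))
      ; w (inLeft (right here) v∈)     → <-irrefl refl (∈-< v∈)
      ; w (inLeft (right (left s)) v∈) → <-asym (∈-< v∈) (node-< s)
      ; w (inLeft (right (right s)) v∈) → 1+n≰n (≤-trans (⊑-≤ˡ s) (∈-≥ v∈)) }
    ; new-child = rightChild here
    ; new-left  = λ { w (inLeft s w∈) →
        inLeft (right here) (∈-⊑ (in-right-subtree u<v s) (∈-⊑ (left here) w∈)) } }
    where u<v = InRight⇒> (RightChild⇒InRight c)
  RightChild-insert (below p) (rightChild (left s)) = inj₁ (rightChild (left s))
  RightChild-insert {v = v} (below {i = k} p) (rightChild (right s)) with RightChild-insert p (rightChild s)
  ... | inj₁ c = inj₁ (RightChild-⊑ (right here) c)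
  ... | inj₂ S = inj₂ record
    { on-right-branch = λ
      { w (inLeft here v∈)      → <⇒≯ k<v (∈-< v∈)
      ; w (inLeft (left s) v∈)  → <⇒≯ k<v (<-trans (∈-< v∈) (node-< s))
      ; w (inLeft (right s) v∈) → on-right-branch w (inLeft s v∈) }
    ; new-child = RightChild-⊑ (right here) new-child
    ; new-left  = λ { w (inLeft s w∈) →
        InLeft-⊑ (right here) (new-left w (inLeft (in-right-subtree k<v s) w∈)) } }
    where
    open Subdivides S
    k<v : k < v
    k<v = ∈-≥ (proj₂ (InRight⇒∈ (RightChild⇒InRight (rightChild s))))

  -- Deletion puts L(b) in the place of `b`, so only relations involving `b` vanish. The largest
  -- vertex lies in no left subtree and has an empty right subtree; hence left relations exclude `b`
  -- as upper end and right ones as lower end.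
  LeftChild-delete : Ins {a} {b} d T U → u ≢ b → LeftChild U u v → LeftChild T u v
  LeftChild-delete top       u≢b (leftChild here)      = contradiction refl u≢b
  LeftChild-delete top       u≢b (leftChild (left s))  = leftChild s
  LeftChild-delete (below p) u≢b (leftChild here)      = leftChild here
  LeftChild-delete (below p) u≢b (leftChild (left s))  = leftChild (left s)
  LeftChild-delete (below p) u≢b (leftChild (right s)) =
    LeftChild-⊑ (right here) (LeftChild-delete p u≢b (leftChild s))

  InLeft-delete : Ins {a} {b} d T U → u ≢ b → InLeft U u v → InLeft T u v
  InLeft-delete top       u≢b (inLeft here v∈)      = contradiction refl u≢b
  InLeft-delete top       u≢b (inLeft (left s) v∈)  = inLeft s v∈
  InLeft-delete (below p) u≢b (inLeft here v∈)      = inLeft here v∈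
  InLeft-delete (below p) u≢b (inLeft (left s) v∈)  = inLeft (left s) v∈
  InLeft-delete (below p) u≢b (inLeft (right s) v∈) =
    InLeft-⊑ (right here) (InLeft-delete p u≢b (inLeft s v∈))

  RightChild-delete : Ins {a} {b} d T U → v ≢ b → RightChild U u v → RightChild T u v
  RightChild-delete top               v≢b (rightChild (left s))  = rightChild s
  RightChild-delete (below top)       v≢b (rightChild here)      = contradiction refl v≢b
  RightChild-delete (below (below p)) v≢b (rightChild here)      = rightChild here
  RightChild-delete (below p)         v≢b (rightChild (left s))  = rightChild (left s)
  RightChild-delete (below p)         v≢b (rightChild (right s)) =
    RightChild-⊑ (right here) (RightChild-delete p v≢b (rightChild s))

  InRight-delete : Ins {a} {b} d T U → v ≢ b → InRight U u v → InRight T u v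
  InRight-delete top       v≢b (inRight here (vertex ()))
  InRight-delete top       v≢b (inRight (left s) v∈)  = inRight s v∈
  InRight-delete (below p) v≢b (inRight here v∈)      =
    inRight here (vertex-of _ (∈-≥ v∈) (≤∧≢⇒< (s≤s⁻¹ (∈-< v∈)) v≢b))
  InRight-delete (below p) v≢b (inRight (left s) v∈)  = inRight (left s) v∈
  InRight-delete (below p) v≢b (inRight (right s) v∈) =
    InRight-⊑ (right here) (InRight-delete p v≢b (inRight s v∈))

-- Containment under insertion and deletion

contains-delete : ∀ {n} {T : 𝒯 n} {U : 𝒯 (suc n)} {π} → Ins d T U →
                  (C : Contains U π) → (∀ i → toℕ (Contains.f C i) ≢ n) → Contains T π
contains-delete {n = n} {T} {U} {π} p C f≢n = record
  { f           = f′
  ; f-injective = λ eq → f-injective (Fin.lower₁-injective eq)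
  ; left-edge   = λ i q c → let cl , il = left-edge i q c in
      (λ ei → subst₂ (LeftChild T) (f′≡f q) (f′≡f i) (LeftChild-delete p (f≢n q) (cl ei))) ,
      (λ ei → subst₂ (InLeft T) (f′≡f q) (f′≡f i) (InLeft-delete p (f≢n q) (il ei)))
  ; right-edge  = λ i q c → let cr , ir = right-edge i q c in
      (λ ei → subst₂ (RightChild T) (f′≡f q) (f′≡f i) (RightChild-delete p (f≢n i) (cr ei))) ,
      (λ ei → subst₂ (InRight T) (f′≡f q) (f′≡f i) (InRight-delete p (f≢n i) (ir ei)))
  }
  where
  open TreePattern π
  open Contains C
  f′ : Fin k → Fin n
  f′ i = lower₁ (f i) (f≢n i ∘ sym)
  f′≡f : ∀ i → toℕ (f i) ≡ toℕ (f′ i)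
  f′≡f i = sym (Fin.toℕ-lower₁ (f i) (f≢n i ∘ sym))

addLast-no-left : {T : Tree a b} → ¬ InLeft (addLast T) b v
addLast-no-left {T = leaf} (inLeft here (vertex ()))
addLast-no-left {T = leaf} (inLeft (left ()) _)
addLast-no-left {T = leaf} (inLeft (right ()) _)
addLast-no-left {T = node i l r} (inLeft here v∈) = 1+n≰n (tree-≤ r)
addLast-no-left {T = node i l r} (inLeft (left s) v∈) = <⇒≯ (tree-≤ r) (node-< s)
addLast-no-left {T = node i l r} (inLeft (right s) v∈) = addLast-no-left {T = r} (inLeft s v∈)

root-no-parent : {T : Tree a b} → ¬ InRight (ext up T) u b
root-no-parent (inRight here (vertex ()))
root-no-parent (inRight (left s) b∈) = <⇒≱ (∈-< b∈) (⊑-≤ʳ s)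

Ins-ext : ∀ δ {T : Tree a b} → ∃ λ d → Ins d T (ext δ T)
Ins-ext up       = _ , top
Ins-ext down {T} = _ , Ins-addLast T

-- Only `max` could be mapped to n. But `max` has both a parent and a left child, while n has no
-- parent as root and no left child as last vertex.
contains-ext⁻¹ : ∀ δ {n} {T : 𝒯 n} {π} → Friendly π → Contains (ext δ T) π → Contains T π
contains-ext⁻¹ δ {n} {T} {π} F C = contains-delete (proj₂ (Ins-ext δ)) C λ i fi≡n →
  case suc (toℕ i) ≟ k of λ
    { (no i≢max)  → embedding-not-largest C i i≢max (cong suc fi≡n)
    ; (yes i≡max) → max-not-largest δ C (subst (λ x → toℕ (Contains.f C x) ≡ n)
        (Fin.toℕ-injective (suc-injective (trans i≡max (sym max-largest)))) fi≡n) }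
  where
  open TreePattern π
  open Friendly F
  max-not-largest : ∀ δ (C : Contains (ext δ T) π) → toℕ (Contains.f C max) ≢ n
  max-not-largest up C f≡n with max-nonroot
  ... | p , inj₁ c with vertexFin (proj₁ (InLeft⇒∈ (LeftChild⇒InLeft c)))
  ...   | p′ , refl = <⇒≢ (<-≤-trans (InLeft⇒< (left-edge-InLeft C {max} {p′} c))
                                     (s≤s⁻¹ (Fin.toℕ<n (Contains.f C p′)))) f≡n
  max-not-largest up C f≡n | p , inj₂ c
    with vertexFin (proj₁ (InRight⇒∈ (RightChild⇒InRight c)))
  ... | p′ , refl = root-no-parent (subst (InRight (ext up T) _) f≡n (right-edge-InRight C {max} {p′} c))
  max-not-largest down C f≡n with max-nonleaf
  ... | c , lc with vertexFin (proj₂ (InLeft⇒∈ (LeftChild⇒InLeft lc)))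
  ...   | c′ , refl = addLast-no-left (subst (λ u → InLeft (addLast T) u _) f≡n
                                         (left-edge-InLeft C {c′} {max} lc))

module _ {n} {T : 𝒯 n} {U : 𝒯 (suc n)} {π} (p : Ins d T U) (F : Friendly π) (C : Contains T π) where
  open TreePattern π
  open Friendly F
  open Contains C

  private
    ≡max : ∀ {i} → suc (toℕ i) ≡ k → i ≡ max
    ≡max eq = Fin.toℕ-injective (suc-injective (trans eq (sym max-largest)))

    f≡ : ∀ i → toℕ (f i) ≡ toℕ (inject₁ (f i))
    f≡ i = sym (Fin.toℕ-inject₁ (f i))

  -- Left edges and edges with e = 0 survive every insertion, so only right edges with e = 1 remain
  -- to be supplied.
  lift-embedding : (∀ i q → RightChild P (toℕ q) (toℕ i) → e i ≡ true →
                    RightChild U (toℕ (f q)) (toℕ (f i))) → Contains U π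
  lift-embedding children = record
    { f           = inject₁ ∘ f
    ; f-injective = λ eq → f-injective (Fin.inject₁-injective eq)
    ; left-edge   = λ i q c → let cl , il = left-edge i q c in
        (λ ei → subst₂ (LeftChild U) (f≡ q) (f≡ i) (LeftChild-insert p (cl ei))) ,
        (λ ei → subst₂ (InLeft U) (f≡ q) (f≡ i) (InLeft-insert p (il ei)))
    ; right-edge  = λ i q c → let cr , ir = right-edge i q c in
        (λ ei → subst₂ (RightChild U) (f≡ q) (f≡ i) (children i q c ei)) ,
        (λ ei → subst₂ (InRight U) (f≡ q) (f≡ i) (InRight-insert p (ir ei)))
    }

  -- If the insertion subdivides the edge of T that carries the edge (q, max) of P,
  -- then the new vertex can take over the role of max.
  move-max : ∀ {q} → RightChild P (toℕ q) (toℕ max) → e max ≡ true →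
             Subdivides T U (toℕ (f q)) (toℕ (f max)) → Contains U π
  move-max {q} c emax S = record
    { f           = f′
    ; f-injective = injective
    ; left-edge   = λ i q → left′ i q (i Fin.≟ max) (q Fin.≟ max)
    ; right-edge  = λ i q → right′ i q (i Fin.≟ max) (q Fin.≟ max)
    }
    where
    open Subdivides S

    f′ : Fin k → Fin (suc n)
    f′ i with i Fin.≟ max
    ... | yes _ = fromℕ n
    ... | no  _ = inject₁ (f i)

    f′-max : n ≡ toℕ (f′ max)
    f′-max with max Fin.≟ max
    ... | yes _  = sym (Fin.toℕ-fromℕ n)
    ... | no m≢m = contradiction refl m≢m

    f′-other : ∀ {i} → i ≢ max → toℕ (f i) ≡ toℕ (f′ i)
    f′-other {i} i≢m with i Fin.≟ max
    ... | yes i≡m = contradiction i≡m i≢m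
    ... | no _    = f≡ i

    injective : ∀ {i j} → f′ i ≡ f′ j → i ≡ j
    injective {i} {j} eq with i Fin.≟ max | j Fin.≟ max
    ... | yes refl | yes refl = refl
    ... | yes refl | no _     = contradiction eq Fin.fromℕ≢inject₁
    ... | no _     | yes refl = contradiction (sym eq) Fin.fromℕ≢inject₁
    ... | no _     | no _     = f-injective (Fin.inject₁-injective eq)

    below-max : ∀ i → toℕ i ≤ toℕ max
    below-max i = s≤s⁻¹ (subst (toℕ i <_) (sym max-largest) (Fin.toℕ<n i))

    left′ : ∀ i q → Dec (i ≡ max) → Dec (q ≡ max) → LeftChild P (toℕ q) (toℕ i) →
            (e i ≡ true  → LeftChild U (toℕ (f′ q)) (toℕ (f′ i))) ×
            (e i ≡ false → InLeft U (toℕ (f′ q)) (toℕ (f′ i)))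
    left′ i q (yes refl) _ c = contradiction (InLeft⇒< (LeftChild⇒InLeft c)) (≤⇒≯ (below-max q))
    -- As `e max` is true, friendliness gives e = 0 on the edge to the left child of `max`; its
    -- image has to lie in L(n), not at the root of it.
    left′ i q (no i≢m) (yes refl) c =
      (λ ei → contradiction (trans (sym ei) (max-edge emax i c)) λ ()) ,
      (λ ei → subst₂ (InLeft U) f′-max (f′-other i≢m)
                (new-left _ (proj₂ (left-edge i max c) ei)))
    left′ i q (no i≢m) (no q≢m) c = let cl , il = left-edge i q c in
      (λ ei → subst₂ (LeftChild U) (f′-other q≢m) (f′-other i≢m) (LeftChild-insert p (cl ei))) ,
      (λ ei → subst₂ (InLeft U) (f′-other q≢m) (f′-other i≢m) (InLeft-insert p (il ei)))

    right′ : ∀ i q → Dec (i ≡ max) → Dec (q ≡ max) → RightChild P (toℕ q) (toℕ i) →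
             (e i ≡ true  → RightChild U (toℕ (f′ q)) (toℕ (f′ i))) ×
             (e i ≡ false → InRight U (toℕ (f′ q)) (toℕ (f′ i)))
    right′ i q′ _ (yes refl) c′ = contradiction (InRight⇒> (RightChild⇒InRight c′)) (≤⇒≯ (below-max i))
    right′ i q′ (yes refl) (no q′≢m) c′ with Fin.toℕ-injective {i = q} {j = q′} (RightChild-injective c c′)
    ... | refl =
      (λ _ → subst₂ (RightChild U) (f′-other q′≢m) f′-max new-child) ,
      (λ ei → contradiction (trans (sym ei) emax) λ ())
    -- A subdivided edge with e = 1 has to end in the image of `max`, so all other edges survive.
    right′ i q′ (no i≢m) (no q′≢m) c′ = let cr , ir = right-edge i q′ c′ in
      (λ ei → subst₂ (RightChild U) (f′-other q′≢m) (f′-other i≢m)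
        (case RightChild-insert p (cr ei) of λ
          { (inj₁ d)  → d
          ; (inj₂ S′) → contradiction
              (≡max (right-branch-vertex C F c′ ei (Subdivides.on-right-branch S′))) i≢m })) ,
      (λ ei → subst₂ (InRight U) (f′-other q′≢m) (f′-other i≢m) (InRight-insert p (ir ei)))

  -- A left child is smaller than its parent, so `max` is a right child, and the edge into it is the
  -- only one at risk.
  contains-insert : Contains U π
  contains-insert with max-nonroot
  ... | q , inj₁ c = contradiction (InLeft⇒< (LeftChild⇒InLeft c)) (≤⇒≯ (s≤s⁻¹
          (subst (q <_) (sym max-largest) (∈-< (proj₁ (InLeft⇒∈ (LeftChild⇒InLeft c)))))))
  ... | q , inj₂ c with vertexFin (proj₁ (InRight⇒∈ (RightChild⇒InRight c)))
  ...   | q′ , refl = by-cases (e max) refl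
    where
    unbroken : (e max ≡ true → RightChild U (toℕ (f q′)) (toℕ (f max))) → Contains U π
    unbroken max-ok = lift-embedding λ i r c′ ei →
      case RightChild-insert p (proj₁ (right-edge i r c′) ei) of λ
        { (inj₁ d) → d
        ; (inj₂ S) → at-max i r c′ ei (≡max (right-branch-vertex C F c′ ei (Subdivides.on-right-branch S))) }
      where
      at-max : ∀ i r → RightChild P (toℕ r) (toℕ i) → e i ≡ true → i ≡ max →
               RightChild U (toℕ (f r)) (toℕ (f i))
      at-max i r c′ ei refl with Fin.toℕ-injective {i = q′} {j = r} (RightChild-injective c c′)
      ... | refl = max-ok ei
    by-cases : ∀ x → e max ≡ x → Contains U π
    by-cases false emax = unbroken λ emax′ → contradiction (trans (sym emax) emax′) λ ()
    by-cases true  emax with RightChild-insert p (proj₁ (right-edge max q′ c) emax)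
    ... | inj₁ d = unbroken λ _ → d
    ... | inj₂ S = move-max c emax S

-- Determinism of Algorithm S

same-or-opposite : ∀ δ δ′ → δ′ ≡ δ ⊎ δ′ ≡ opposite δ
same-or-opposite up   up   = inj₁ refl
same-or-opposite up   down = inj₂ refl
same-or-opposite down up   = inj₂ refl
same-or-opposite down down = inj₁ refl

module _ {n} {ℒ : 𝒯 n → Set} where

  -- Of two minimal slides of different lengths the shorter would end in ℒ and refute the minimality
  -- of the longer.
  minimalSlide-functional : ∀ {δ j T U V} →
                            MinimalSlide ℒ δ j T U → MinimalSlide ℒ δ j T V → U ≡ V
  minimalSlide-functional {δ} M N with <-cmp (MinimalSlide.steps M) (MinimalSlide.steps N)
  ... | tri< lt _ _ = contradiction (MinimalSlide.inside M)
    (MinimalSlide.minimal N _ _ (MinimalSlide.nonempty M) lt (MinimalSlide.slide M))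
  ... | tri> _ _ gt = contradiction (MinimalSlide.inside N)
    (MinimalSlide.minimal M _ _ (MinimalSlide.nonempty N) gt (MinimalSlide.slide N))
  ... | tri≈ _ eq _ = slide-functional δ
    (subst (λ d → Slide δ _ d _ _) eq (MinimalSlide.slide M)) (MinimalSlide.slide N)

  module _ {T₀ : 𝒯 n} where
    open AlgorithmS ℒ T₀

    S2-functional : ∀ {T h U V} → S2 T h U → S2 T h V → U ≡ V
    S2-functional p q with <-cmp (S2.j p) (S2.j q)
    ... | tri< lt _ _ = contradiction (S2.new q) (S2.largest p _ _ _ lt)
    ... | tri> _ _ gt = contradiction (S2.new p) (S2.largest q _ _ _ gt)
    ... | tri≈ _ eq _ with same-or-opposite (S2.δ p) (S2.δ q)
    ...   | inj₁ refl with refl ← eq = minimalSlide-functional (proj₁ (S2.new p)) (proj₁ (S2.new q))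
    ...   | inj₂ refl with refl ← eq = contradiction (S2.new q) (S2.unambiguous p _)

    infix 4 _≼_

    -- Histories list the newest tree first, so an initial segment of a run is a suffix of the list.
    data _≼_ (h : History) : History → Set where
      same   : h ≼ h
      longer : ∀ {T h′} → h ≼ h′ → h ≼ T ∷ h′

    first-≼ : ∀ {h} → Reachable h → T₀ ∷ [] ≼ h
    first-≼ visit₀      = same
    first-≼ (visit R _) = longer (first-≼ R)

    next-≼ : ∀ {T g U h} → Reachable (U ∷ h) → T ∷ g ≼ h → ∃ λ V → S2 T g V × V ∷ T ∷ g ≼ U ∷ h
    next-≼ visit₀      ()
    next-≼ (visit R s) same       = _ , s , same
    next-≼ (visit R s) (longer p) with V , s′ , q ← next-≼ R p = V , s′ , longer q

    -- By determinism each further visit repeats the next one of the terminated run, and the run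
    -- cannot be outlasted because its last tree admits no step.
    reachable-≼-run : ∀ {T h g} → Reachable (T ∷ h) → (∀ U → ¬ S2 T h U) →
                      Reachable g → g ≼ T ∷ h
    reachable-≼-run R stuck visit₀ = first-≼ R
    reachable-≼-run R stuck (visit R′ s) with reachable-≼-run R stuck R′
    ... | same     = contradiction s (stuck _)
    ... | longer p with _ , s′ , q ← next-≼ R p with refl ← S2-functional s s′ = q

    run-unique : ∀ {h h′} → Run h → Run h′ → h′ ≡ h
    run-unique (terminate R stuck) (terminate R′ stuck′) with reachable-≼-run R stuck R′
    ... | same     = refl
    ... | longer p = contradiction (proj₁ (proj₂ (next-≼ R p))) (stuck′ _)

    reachable-unique : ∀ {h} → Reachable h → Unique h
    reachable-unique visit₀      = [] ∷ []
    reachable-unique (visit R s) = ¬Any⇒All¬ _ (proj₂ (S2.new s)) ∷ reachable-unique R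

-- The insertions into a fixed tree, in the order in which a slide passes them

-- The position `t` counts the steps from the end opposite to δ, so that a slide in direction δ adds
-- its length. Upwards the depth falls as `t` grows; the equation expresses this without
-- subtraction.
Pos : Direction → ℕ → Tree a b → Tree a (suc b) → Set
Pos down t T U = Ins t T U
Pos up   t T U = ∃ λ d → d + t ≡ branchLength T × Ins d T U

module _ {T : Tree a b} where

  Pos-start : ∀ δ → Pos (opposite δ) 0 T (ext δ T)
  Pos-start up   = top
  Pos-start down = _ , +-identityʳ _ , Ins-addLast T

  Pos-end : ∀ δ → Pos δ (branchLength T) T (ext δ T)
  Pos-end up   = 0 , refl , top
  Pos-end down = Ins-addLast T

  Pos⇒Ins : ∀ δ {t U} → Pos δ t T U → ∃ λ d → Ins d T U
  Pos⇒Ins up   (_ , _ , p) = _ , p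
  Pos⇒Ins down p           = _ , p

  Ins⇒Pos : ∀ δ {d U} → Ins d T U → ∃ λ t → Pos δ t T U
  Ins⇒Pos up   p = _ , _ , m+[n∸m]≡n (Ins-≤ p) , p
  Ins⇒Pos down p = _ , p

  Pos-≤ : ∀ δ {t U} → Pos δ t T U → t ≤ branchLength T
  Pos-≤ up   (d , eq , _) = subst (_ ≤_) eq (m≤n+m _ d)
  Pos-≤ down p            = Ins-≤ p

  Pos-functional : ∀ δ {t U V} → Pos δ t T U → Pos δ t T V → U ≡ V
  Pos-functional up {t} (d , eq , p) (d′ , eq′ , q)
    with refl ← +-cancelʳ-≡ t d d′ (trans eq (sym eq′)) = Ins-functional p q
  Pos-functional down p q = Ins-functional p q

  Pos-injective : ∀ δ {t t′ U} → Pos δ t T U → Pos δ t′ T U → t ≡ t′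
  Pos-injective up (d , eq , p) (d′ , eq′ , q) with refl , _ ← Ins-injective p q =
    +-cancelˡ-≡ d _ _ (trans eq (sym eq′))
  Pos-injective down p q = proj₁ (Ins-injective p q)

  Pos-rotation : ∀ δ {t U V} → Pos δ t T U → Rotation δ b U V → Pos δ (suc t) T V
  Pos-rotation up (d , eq , p) q with d′ , refl , p′ ← Ins-up p q =
    d′ , trans (+-suc d′ _) eq , p′
  Pos-rotation down p q = Ins-down p q

  Pos-rotation-back : ∀ δ {t U V} → Pos δ t T U → Rotation (opposite δ) b U V →
                      ∃ λ t′ → t ≡ suc t′ × Pos δ t′ T V
  -- At upward position 0 the new vertex is the last of the branch; one more down-rotation would
  -- exceed the maximal depth.
  Pos-rotation-back up {zero} (d , eq , p) q =
    contradiction (Ins-≤ (Ins-down p q)) (subst (suc d ≰_) (trans (sym (+-identityʳ d)) eq) 1+n≰n)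
  Pos-rotation-back up {suc t} (d , eq , p) q =
    t , refl , suc d , trans (sym (+-suc d t)) eq , Ins-down p q
  Pos-rotation-back down p q = Ins-up p q

  Pos-next : ∀ δ {t U} → Pos δ t T U → t < branchLength T → ∃ (Rotation δ b U)
  Pos-next up (zero , eq , p) t< = contradiction (sym eq) (>⇒≢ t<)
  Pos-next up (suc d , eq , p) t< = rotatable-up p
  Pos-next down p t< = rotatable-down p t<

  Pos-slide : ∀ δ {t d U V} → Pos δ t T U → Slide δ b d U V → Pos δ (t + d) T V
  Pos-slide δ {t} {V = V} p done = subst (λ s → Pos δ s T V) (sym (+-identityʳ t)) p
  Pos-slide δ {t} {V = V} p (step {d} q s) =
    subst (λ s → Pos δ s T V) (sym (+-suc t d)) (Pos-slide δ (Pos-rotation δ p q) s)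

  Pos-slide-back : ∀ δ {t d U V} → Pos δ t T U → Slide (opposite δ) b d U V →
                   ∃ λ t′ → t′ ≤ t × Pos δ t′ T V
  Pos-slide-back δ p done = _ , ≤-refl , p
  Pos-slide-back δ p (step q s) with _ , refl , p′ ← Pos-rotation-back δ p q
    with t′ , t′≤t , p″ ← Pos-slide-back δ p′ s = t′ , m≤n⇒m≤1+n t′≤t , p″

slide-snoc : ∀ δ {d} {T U V : Tree a b} → Slide δ j d T U → Rotation δ j U V → Slide δ j (suc d) T V
slide-snoc δ done       q = step q done
slide-snoc δ (step p s) q = step p (slide-snoc δ s q)

slide-< : ∀ δ {d} {T U : Tree a b} → 0 < d → Slide δ j d T U → j < b
slide-< up   0<d (step q _) = UpRotation-< q
slide-< down 0<d (step q _) = UpRotation-< q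

-- Zigzag languages

module Zigzag
  (ℒ         : ∀ {n} → 𝒯 n → Set)
  (ℒ?        : ∀ {n} (T : 𝒯 n) → Dec (ℒ T))
  (ℒ-leaf    : ℒ leaf)
  (ℒ-ext     : ∀ δ {n} {T : 𝒯 n} → ℒ T → ℒ (ext δ T))
  (ℒ-deleted : ∀ {n d} {T : 𝒯 n} {U} → Ins d T U → ℒ U → ℒ T)
  where

  Over : ∀ {n} → List (𝒯 n) → 𝒯 (suc n) → Set
  Over h V = ∃ λ T → T ∈ h × ∃ λ d → Ins d T V

  -- The invariant on histories: `sound` shows that the target of a slide is new, `complete` that it
  -- has been visited.
  record _Represents_ {n} (H : List (𝒯 n)) (Q : 𝒯 n → Set) : Set where
    field
      sound    : ∀ {V} → V ∈ H → ℒ V × Q V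
      complete : ∀ {V} → ℒ V → Q V → V ∈ H

  open _Represents_

  module Level (n : ℕ) where
    module S  = AlgorithmS (ℒ {n}) (rightPath n)
    module S⁺ = AlgorithmS (ℒ {suc n}) (rightPath (suc n))

    -- One sweep through the insertions into a single tree

    module Block (δ : Direction) {T : 𝒯 n} {h : List (𝒯 n)} (T∉h : T ∉ h) (ℒT : ℒ T) where

      Swept : ℕ → 𝒯 (suc n) → Set
      Swept t V = Over h V ⊎ ∃ λ t′ → t′ ≤ t × Pos δ t′ T V

      Finished : Set
      Finished = ∃ λ H → S⁺.Reachable (ext δ T ∷ H) × (ext δ T ∷ H) Represents Over (T ∷ h)

      finish : ∀ {U H} → S⁺.Reachable (U ∷ H) → (U ∷ H) Represents Swept (branchLength T) →
               Pos δ (branchLength T) T U → Finished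
      finish {H = H} R rep pU with refl ← Pos-functional δ pU (Pos-end δ) = H , R , record
        { sound    = λ V∈ → case sound rep V∈ of λ
          { (ℒV , inj₁ (T′ , T′∈h , p)) → ℒV , T′ , there T′∈h , p
          ; (ℒV , inj₂ (_ , _ , p))     → ℒV , T , here refl , Pos⇒Ins δ p }
        ; complete = λ
          { ℒV (T′ , there T′∈h , p)   → complete rep ℒV (inj₁ (T′ , T′∈h , p))
          ; ℒV (_ , here refl , _ , p) → case Ins⇒Pos δ p of λ
            { (t′ , p′) → complete rep ℒV (inj₂ (t′ , Pos-≤ δ p′ , p′)) } } }

      -- U is the last visited insertion, at position t, and the next g insertions
      -- have already been found to be outside ℒ.
      sweep : ∀ k {t g U W H} → t + g + k ≡ branchLength T →
              S⁺.Reachable (U ∷ H) → (U ∷ H) Represents Swept t → Pos δ t T U → Slide δ n g U W →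
              (∀ {t′ V} → t < t′ → t′ ≤ t + g → Pos δ t′ T V → ¬ ℒ V) → Finished
      -- The number `k` counts the insertions still untested. When none is left, `U` must be the
      -- final insertion: otherwise the gap would contain `ext δ T`, which belongs to ℒ.
      sweep zero {t} {g} eq R rep pU s gap
        with refl ← ≤-antisym (Pos-≤ δ pU) (≮⇒≥ λ t<length →
          gap t<length (≤-reflexive (sym (trans (sym (+-identityʳ (t + g))) eq)))
              (Pos-end δ) (ℒ-ext δ ℒT)) = finish R rep pU
      sweep (suc k) {t} {g} {U} {W} {H} eq R rep pU s gap with Pos-next δ (Pos-slide δ pU s) t+g<length
        where
        t+g<length : t + g < branchLength T
        t+g<length = subst (t + g <_) eq (m<m+n (t + g) (s≤s z≤n))
      ... | W′ , q = continue (ℒ? W′)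
        where
        s′ : Slide δ n (suc g) U W′
        s′ = slide-snoc δ s q

        pW′ : Pos δ (t + suc g) T W′
        pW′ = Pos-slide δ pU s′

        t<t+suc-g : t < t + suc g
        t<t+suc-g = m<m+n t (s≤s z≤n)

        eq′ : t + suc g + k ≡ branchLength T
        eq′ = trans (cong (_+ k) (+-suc t g)) (trans (sym (+-suc (t + g) k)) eq)

        new-position : ∀ {t′} → t′ ≤ t + suc g → t′ ≤ t + g ⊎ t′ ≡ t + suc g
        new-position {t′} t′≤ with m≤n⇒m<n∨m≡n t′≤
        ... | inj₁ t′< = inj₁ (s≤s⁻¹ (subst (t′ <_) (+-suc t g) t′<))
        ... | inj₂ t′≡ = inj₂ t′≡

        -- An insertion determines the tree and the position it comes from: the tree `T` is new, and
        -- the position is beyond all those swept.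
        unvisited : W′ ∉ U ∷ H
        unvisited W′∈ with sound rep W′∈
        ... | _ , inj₁ (T′ , T′∈h , d , p) with _ , p′ ← Pos⇒Ins δ pW′
          with _ , refl ← Ins-injective p p′ = T∉h T′∈h
        ... | _ , inj₂ (t′ , t′≤t , p) with refl ← Pos-injective δ p pW′ = <⇒≱ t<t+suc-g t′≤t

        continue : Dec (ℒ W′) → Finished
        continue (no ¬ℒW′) = sweep k eq′ R rep pU s′ λ t<t′ t′≤ p → case new-position t′≤ of λ
          { (inj₁ t′≤t+g) → gap t<t′ t′≤t+g p
          ; (inj₂ refl)   → subst (¬_ ∘ ℒ) (Pos-functional δ pW′ p) ¬ℒW′ }
        continue (yes ℒW′) = sweep k {t = t + suc g} {g = 0}
          (trans (cong (_+ k) (+-identityʳ (t + suc g))) eq′)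
          (S⁺.visit R S2-W′) rep′ pW′ done
          (λ {t′} t<t′ t′≤ _ → contradiction (subst (t′ ≤_) (+-identityʳ (t + suc g)) t′≤) (<⇒≱ t<t′))
          where
          S2-W′ : S⁺.S2 U H W′
          S2-W′ = record
            { δ           = δ
            ; j           = n
            ; new         = record
              { steps    = suc g
              ; nonempty = s≤s z≤n
              ; slide    = s′
              ; inside   = ℒW′
              -- Shorter slides end inside the gap.
              ; minimal  = λ d V 0<d d<steps s″ →
                  gap (m<m+n t 0<d) (+-monoʳ-≤ t (s≤s⁻¹ d<steps)) (Pos-slide δ pU s″)
              } , unvisited
            ; largest     = λ δ′ j′ V n<j′ (M , _) →
                <⇒≱ (slide-< δ′ (MinimalSlide.nonempty M) (MinimalSlide.slide M)) n<j′
            -- Sliding back meets only positions already swept.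
            ; unambiguous = λ V (M , V∉) →
                V∉ (complete rep (MinimalSlide.inside M)
                     (inj₂ (Pos-slide-back δ pU (MinimalSlide.slide M))))
            }
          rep′ : (W′ ∷ U ∷ H) Represents Swept (t + suc g)
          sound rep′ (here refl) = ℒW′ , inj₂ (_ , ≤-refl , pW′)
          sound rep′ (there V∈) with sound rep V∈
          ... | ℒV , inj₁ o = ℒV , inj₁ o
          ... | ℒV , inj₂ (t′ , t′≤t , p) = ℒV , inj₂ (t′ , ≤-trans t′≤t (<⇒≤ t<t+suc-g) , p)
          complete rep′ ℒV (inj₁ o) = there (complete rep ℒV (inj₁ o))
          complete rep′ ℒV (inj₂ (t′ , t′≤ , p)) with new-position t′≤
          ... | inj₂ refl = here (Pos-functional δ p pW′)
          -- Positions beyond `t` but before the new one lie in the gap, outside ℒ.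
          ... | inj₁ t′≤t+g with t′ ≤? t
          ...   | yes t′≤t = there (complete rep ℒV (inj₂ (t′ , t′≤t , p)))
          ...   | no  t′≰t = contradiction ℒV (gap (≰⇒> t′≰t) t′≤t+g p)

      start-sweep : ∀ {H U} → Pos δ 0 T U → ℒ U → S⁺.Reachable (U ∷ H) → H Represents Over h →
                    Finished
      start-sweep {H} {U} pU ℒU R rep =
        sweep (branchLength T) refl R rep′ pU done (λ 0<t′ t′≤0 → contradiction t′≤0 (<⇒≱ 0<t′))
        where
        rep′ : (U ∷ H) Represents Swept 0
        sound rep′ (here refl) = ℒU , inj₂ (0 , z≤n , pU)
        sound rep′ (there V∈) with ℒV , o ← sound rep V∈ = ℒV , inj₁ o
        complete rep′ ℒV (inj₁ o)            = there (complete rep ℒV o)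
        complete rep′ ℒV (inj₂ (_ , z≤n , p)) = here (Pos-functional δ p pU)

    -- The step from one sweep to the next

    module BlockEnd (δ : Direction) {T : 𝒯 n} {h : List (𝒯 n)} {H : List (𝒯 (suc n))}
                    (rep : (ext δ T ∷ H) Represents Over (T ∷ h)) where

      represents-ext : ∀ {V} → ℒ V → V ∈ T ∷ h → ext δ V ∈ ext δ T ∷ H
      represents-ext ℒV V∈ = complete rep (ℒ-ext δ ℒV) (_ , V∈ , Ins-ext δ)

      represents-ext⁻¹ : ∀ {V} → ext δ V ∈ ext δ T ∷ H → V ∈ T ∷ h
      represents-ext⁻¹ V∈ with _ , _ , V′∈ , _ , p ← sound rep V∈
        with _ , refl ← Ins-injective p (proj₂ (Ins-ext δ)) = V′∈

      lift-newSlide : ∀ {δ′ j V} → S.NewSlide (T ∷ h) T δ′ j V →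
                      S⁺.NewSlide (ext δ T ∷ H) (ext δ T) δ′ j (ext δ V)
      lift-newSlide {δ′} (M , V∉) = record
        { steps    = steps
        ; nonempty = nonempty
        ; slide    = ext-slide δ slide
        ; inside   = ℒ-ext δ inside
        ; minimal  = λ d V 0<d d< s ℒV → case ext-slide⁻¹ δ (<⇒≢ (slide-< δ′ nonempty slide)) s of λ
          { (V′ , refl , s′) → minimal d V′ 0<d d< s′ (ℒ-deleted (proj₂ (Ins-ext δ)) ℒV) }
        } , V∉ ∘ represents-ext⁻¹
        where open MinimalSlide M

      lower-newSlide : ∀ {δ′ j V} → j ≢ n → S⁺.NewSlide (ext δ T ∷ H) (ext δ T) δ′ j V →
                       ∃ λ V′ → S.NewSlide (T ∷ h) T δ′ j V′
      lower-newSlide j≢n (M , V∉) with V′ , refl , s′ ← ext-slide⁻¹ δ j≢n (MinimalSlide.slide M) =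
        V′ , record
          { steps    = steps
          ; nonempty = nonempty
          ; slide    = s′
          ; inside   = ℒV′
          ; minimal  = λ d V 0<d d< s ℒV → minimal d (ext δ V) 0<d d< (ext-slide δ s) (ℒ-ext δ ℒV)
          } , V∉ ∘ represents-ext ℒV′
        where
        open MinimalSlide M
        ℒV′ = ℒ-deleted (proj₂ (Ins-ext δ)) inside

      -- Onwards the right branch is exhausted; backwards every insertion in ℒ has been visited.
      no-newSlide : ∀ {δ′ V} → ¬ S⁺.NewSlide (ext δ T ∷ H) (ext δ T) δ′ n V
      no-newSlide {δ′} (M , V∉) with same-or-opposite δ δ′
      ... | inj₁ refl = <⇒≱ (m<m+n (branchLength T) nonempty) (Pos-≤ δ (Pos-slide δ (Pos-end δ) slide))
        where open MinimalSlide M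
      ... | inj₂ refl with _ , _ , p ← Pos-slide-back δ (Pos-end δ) (MinimalSlide.slide M) =
        V∉ (complete rep (MinimalSlide.inside M) (T , here refl , Pos⇒Ins δ p))

      no-slides : ∀ {δ′ j} → (∀ V → ¬ S.NewSlide (T ∷ h) T δ′ j V) →
                  ∀ V → ¬ S⁺.NewSlide (ext δ T ∷ H) (ext δ T) δ′ j V
      no-slides {j = j} none V new with j ≟ n
      ... | yes refl = no-newSlide new
      ... | no  j≢n  = none _ (proj₂ (lower-newSlide j≢n new))

      lift-S2 : ∀ {V} → S.S2 T h V → S⁺.S2 (ext δ T) H (ext δ V)
      lift-S2 s = record
        { new         = lift-newSlide new
        ; largest     = λ δ′ j′ V j<j′ → no-slides (λ V′ → largest δ′ j′ V′ j<j′) V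
        ; unambiguous = no-slides unambiguous
        }
        where open S.S2 s

      lower-S2 : ∀ {V} → S⁺.S2 (ext δ T) H V → ∃ (S.S2 T h)
      lower-S2 s with S⁺.S2.j s ≟ n
      ... | yes refl = contradiction (S⁺.S2.new s) no-newSlide
      ... | no  j≢n  = _ , record
        { new         = proj₂ (lower-newSlide j≢n new)
        ; largest     = λ δ′ j′ V j<j′ new′ → largest δ′ j′ _ j<j′ (lift-newSlide new′)
        ; unambiguous = λ V new′ → unambiguous _ (lift-newSlide new′)
        }
        where open S⁺.S2 s

    rightPath-ℒ : ∀ n → ℒ (rightPath n)
    rightPath-ℒ zero    = ℒ-leaf
    rightPath-ℒ (suc n) = ℒ-ext down (rightPath-ℒ n)

    lift-reachable : ∀ {T h} → S.Reachable (T ∷ h) →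
                     ∃ λ δ → ∃ λ H → S⁺.Reachable (ext δ T ∷ H) × (ext δ T ∷ H) Represents Over (T ∷ h)
    lift-reachable S.visit₀ =
      -- The right path has its largest vertex last, so the first sweep goes up.
      up , Block.start-sweep up (λ ()) (rightPath-ℒ n) (Pos-start down) (rightPath-ℒ (suc n)) S⁺.visit₀
             record { sound = λ () ; complete = λ { _ (_ , () , _) } }
    lift-reachable (S.visit R s) with δ , H , R⁺ , rep ← lift-reachable R =
      -- The lifted step leaves n at the end `ext δ`, which is position 0 of the opposite direction.
      opposite δ , Block.start-sweep (opposite δ) (proj₂ new) inside (Pos-start δ) (ℒ-ext δ inside)
                     (S⁺.visit R⁺ (BlockEnd.lift-S2 δ rep s)) rep
      where
      open S.S2 s using (new)
      open MinimalSlide (proj₁ new) using (inside)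

  -- Induction on the number of vertices

  CompleteRun : ℕ → Set
  CompleteRun n = ∃ λ h → AlgorithmS.Run (ℒ {n}) (rightPath n) h × (∀ T → ℒ T ⇔ T ∈ h)

  completeRun : ∀ n → CompleteRun n
  completeRun zero = leaf ∷ [] , AlgorithmS.terminate AlgorithmS.visit₀ stuck ,
      λ { leaf → mk⇔ (λ _ → here refl) (λ _ → ℒ-leaf)
        ; (node i l r) → contradiction (tree-≤ r) λ () }
    where
    open AlgorithmS (ℒ {0}) (rightPath 0) using (S2)
    stuck : ∀ T → ¬ S2 leaf [] T
    stuck T s with slide-< (S2.δ s) nonempty slide
      where open MinimalSlide (proj₁ (S2.new s))
    ... | ()
  completeRun (suc n) with completeRun n
  ... | (T ∷ h) , AlgorithmS.terminate R stuck , all with Level.lift-reachable n R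
  ...   | δ , H , R⁺ , rep = ext δ T ∷ H ,
    AlgorithmS.terminate R⁺ (λ U s → stuck _ (proj₂ (Level.BlockEnd.lower-S2 n δ rep s))) ,
    λ U → mk⇔
      -- Deleting the largest vertex of `U` gives a tree of ℒ, visited by the induction hypothesis,
      -- so `U` lies in its block.
      (λ ℒU → case Ins-surjective z≤n U of λ
        { (T′ , d , p) → complete rep ℒU (T′ , Equivalence.to (all T′) (ℒ-deleted p ℒU) , d , p) })
      (λ U∈ → proj₁ (sound rep U∈))

  visitsExactlyOnce : ∀ n → AlgorithmS.VisitsExactlyOnce (ℒ {n}) (rightPath n)
  visitsExactlyOnce n with completeRun n
  -- Determinism extends what holds of the constructed run to every run.
  ... | h , run@(AlgorithmS.terminate R _) , all = (h , run) , λ h′ run′ → case run-unique run run′ of λ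
    { refl → reachable-unique R , all }

theorem3 : (πs : List TreePattern) → All Friendly πs → (n : ℕ) → AlgorithmS.VisitsExactlyOnce (Avoiding πs {n}) (rightPath n)
theorem3 πs friendly n = Zigzag.visitsExactlyOnce (λ {n} → Avoiding πs {n})
  (λ T → All.all? (λ π → ¬? (contains? T π)) πs)
  -- A friendly pattern has the vertex `max`, which has no image in the empty tree.
  (All.map (λ F C → Fin.¬Fin0 (Contains.f C (Friendly.max F))) friendly)
  (λ δ avoids → All.zipWith (λ (F , ¬C) C → ¬C (contains-ext⁻¹ δ F C)) (friendly , avoids))
  (λ p avoids → All.zipWith (λ (F , ¬C) C → ¬C (contains-insert p F C)) (friendly , avoids))
  n
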